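{- For any real $\alpha$ with $0<\alpha<\frac{3+\sqrt5}2$, no deterministic online algorithm (not necessarily monotone) for maximizing a non-negative monotone submodular function under a partition matroid constraint with free disposal, on instances of the form described in the context (all parts of capacity $1$), can have competitive ratio strictly larger than $\frac1\alpha$.
   Context: Instances: let $\mathcal{U}$ be a universe of items with weights $\nu:\mathcal{U}\to\mathbb{R}_+$, and $\nu(X):=\sum_{x\in X}\nu(x)$ for $X\subseteq\mathcal{U}$. For $i\ge0$ let $\Omega_i:=\{(u,i):u\in\mathcal{U}\}$ and let $\Omega:=\bigcup_{i\ge0}\Omega_i$. A (finite) set $S\subset\Omega$ is independent iff $|S\cap\Omega_i|\le1$ for all $i$ (a partition matroid with unit capacities). The objective is $f(S):=\nu(\{x:(x,i)\in S\text{ for some }i\})$, which is monotone submodular. Online problem with free disposal: distinct elements of $\Omega$ arrive one by one in a finite sequence whose length is unknown to the algorithm. The algorithm maintains an independent set $S$, initially empty. When $u$ arrives, it may remove elements from $S$ and may include $u$ in $S$, as long as $S$ remains independent; rejected or removed elements cannot be retrieved. The algorithm has a value oracle for $f$ and an independence oracle, only on sets of elements that have arrived so far, so the decisions of a deterministic algorithm are determined by this information. $\mathsf{OPT}$ is an independent set of elements of the sequence maximizing $f$. A deterministic algorithm has competitive ratio $r$ if for every instance and at the end of every finite sequence, $f(S)\ge r\cdot f(\mathsf{OPT})$. -}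

module Defs where

open import Data.Bool using (Bool)
open import Data.Empty using (⊥-elim)
open import Data.Fin.Subset using (Subset; inside; outside; _∩_)
import Data.Integer as ℤ
import Data.Integer.Properties as ℤₚ
open import Data.List using (List; []; _∷_; map; foldr; filter; length; deduplicate)
open import Data.List.Properties using (filter-none)
open import Data.List.Relation.Unary.All as All using ()
open import Data.List.Relation.Unary.All.Properties using (¬Any⇒All¬)
open import Data.List.Relation.Unary.Any as Any using (Any)
open import Data.Nat as ℕ using (ℕ; zero; suc)
import Data.Nat.Properties as ℕₚ
import Data.Nat.Solver
open import Data.Product using (∃-syntax; _×_; _,_; proj₁; proj₂)
open import Data.Rational as ℚ using (ℚ; 0ℚ; 1ℚ; ½)
import Data.Rational.Properties as ℚₚ
import Data.Rational.Solver
import Data.Rational.Unnormalised as ℚᵘ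
import Data.Rational.Unnormalised.Properties as ℚᵘₚ
open import Data.Vec using (Vec; []; _∷_)
open import Data.Vec.Relation.Unary.Unique.Propositional using (Unique)
open import Data.Sum using (inj₁; inj₂)
open import Relation.Binary.Definitions using (DecidableEquality)
open import Relation.Binary.PropositionalEquality
  using (_≡_; refl; sym; trans; cong; cong₂; subst; subst₂)
open import Relation.Nullary using (¬_; Dec; yes; no; does)

------------------------------------------------------------------------
-- Real numbers, as Cauchy sequences of rationals with equality _≃ᵣ_.

IsCauchy : (ℕ → ℚ) → Set
IsCauchy x = ∀ ε → 0ℚ ℚ.< ε →
  ∃[ N ] (∀ m n → N ℕ.≤ m → N ℕ.≤ n → ℚ.∣ x m ℚ.- x n ∣ ℚ.< ε)

record ℝ : Set where
  constructor mkℝ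
  field
    seq    : ℕ → ℚ
    cauchy : IsCauchy seq

open ℝ public

infix 4 _≃ᵣ_ _<ᵣ_ _≤ᵣ_

_≃ᵣ_ : ℝ → ℝ → Set
x ≃ᵣ y = ∀ ε → 0ℚ ℚ.< ε →
  ∃[ N ] (∀ n → N ℕ.≤ n → ℚ.∣ seq x n ℚ.- seq y n ∣ ℚ.< ε)

_<ᵣ_ : ℝ → ℝ → Set
x <ᵣ y = ∃[ ε ] (0ℚ ℚ.< ε) ×
  (∃[ N ] (∀ n → N ℕ.≤ n → seq x n ℚ.+ ε ℚ.< seq y n))

_≤ᵣ_ : ℝ → ℝ → Set
x ≤ᵣ y = ¬ (y <ᵣ x)

module ℚS = Data.Rational.Solver.+-*-Solver
module ℕS = Data.Nat.Solver.+-*-Solver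

half-pos : ∀ {ε} → 0ℚ ℚ.< ε → 0ℚ ℚ.< ½ ℚ.* ε
half-pos {ε} 0<ε = subst (ℚ._< ½ ℚ.* ε) (ℚₚ.*-zeroʳ ½) (ℚₚ.*-monoʳ-<-pos ½ 0<ε)

half+half : ∀ ε → ½ ℚ.* ε ℚ.+ ½ ℚ.* ε ≡ ε
half+half ε = trans (sym (ℚₚ.*-distribʳ-+ ε ½ ½)) (ℚₚ.*-identityˡ ε)

*-pos : ∀ {p q} → 0ℚ ℚ.< p → 0ℚ ℚ.< q → 0ℚ ℚ.< p ℚ.* q
*-pos {p} {q} 0<p 0<q = subst (ℚ._< p ℚ.* q) (ℚₚ.*-zeroʳ p)
  (ℚₚ.*-monoʳ-<-pos p {{ℚ.positive 0<p}} 0<q)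

*-mono-≤-nonNeg : ∀ {p q r s} → 0ℚ ℚ.≤ p → 0ℚ ℚ.≤ s →
           p ℚ.≤ q → r ℚ.≤ s → p ℚ.* r ℚ.≤ q ℚ.* s
*-mono-≤-nonNeg {p} {q} {r} {s} 0≤p 0≤s p≤q r≤s = ℚₚ.≤-trans
  (ℚₚ.*-monoˡ-≤-nonNeg p {{ℚ.nonNegative 0≤p}} r≤s)
  (ℚₚ.*-monoʳ-≤-nonNeg s {{ℚ.nonNegative 0≤s}} p≤q)

inv : (p : ℚ) → 0ℚ ℚ.< p → ℚ
inv p 0<p = (ℚ.1/ p) {{ℚ.>-nonZero 0<p}}

inv-pos : ∀ p (0<p : 0ℚ ℚ.< p) → 0ℚ ℚ.< inv p 0<p
inv-pos p 0<p = ℚₚ.positive⁻¹ (inv p 0<p) {{ℚₚ.1/pos⇒pos p {{ℚ.positive 0<p}}}}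

inv-inverseʳ : ∀ p (0<p : 0ℚ ℚ.< p) → p ℚ.* inv p 0<p ≡ 1ℚ
inv-inverseʳ p 0<p = ℚₚ.*-inverseʳ p {{ℚ.>-nonZero 0<p}}

inv-cancel : ∀ p (0<p : 0ℚ ℚ.< p) q → p ℚ.* (inv p 0<p ℚ.* q) ≡ q
inv-cancel p 0<p q = trans (sym (ℚₚ.*-assoc p (inv p 0<p) q))
  (trans (cong (ℚ._* q) (inv-inverseʳ p 0<p)) (ℚₚ.*-identityˡ q))

eventuallyBounded : ∀ x → IsCauchy x →
  ∃[ B ] (0ℚ ℚ.< B) × (∃[ N ] (∀ n → N ℕ.≤ n → ℚ.∣ x n ∣ ℚ.≤ B))
eventuallyBounded x c with c 1ℚ (ℚₚ.positive⁻¹ 1ℚ)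
... | N , close = 1ℚ ℚ.+ ℚ.∣ x N ∣ ,
  ℚₚ.+-mono-<-≤ (ℚₚ.positive⁻¹ 1ℚ) (ℚₚ.0≤∣p∣ (x N)) , N , bound
  where
  bound : ∀ n → N ℕ.≤ n → ℚ.∣ x n ∣ ℚ.≤ 1ℚ ℚ.+ ℚ.∣ x N ∣
  bound n N≤n = ℚₚ.≤-trans
    (ℚₚ.≤-reflexive (cong ℚ.∣_∣
      (ℚS.solve 2 (λ a b → a ℚS.:= (a ℚS.:- b) ℚS.:+ b) refl (x n) (x N))))
    (ℚₚ.≤-trans (ℚₚ.∣p+q∣≤∣p∣+∣q∣ (x n ℚ.- x N) (x N))
      (ℚₚ.+-monoˡ-≤ ℚ.∣ x N ∣ (ℚₚ.<⇒≤ (close n N N≤n ℕₚ.≤-refl))))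

∣+-+∣≤ : ∀ a b c d → ℚ.∣ (a ℚ.+ b) ℚ.- (c ℚ.+ d) ∣ ℚ.≤ ℚ.∣ a ℚ.- c ∣ ℚ.+ ℚ.∣ b ℚ.- d ∣
∣+-+∣≤ a b c d = subst (λ p → ℚ.∣ p ∣ ℚ.≤ ℚ.∣ a ℚ.- c ∣ ℚ.+ ℚ.∣ b ℚ.- d ∣)
  (ℚS.solve 4 (λ a b c d →
    (a ℚS.:- c) ℚS.:+ (b ℚS.:- d) ℚS.:= (a ℚS.:+ b) ℚS.:- (c ℚS.:+ d)) refl a b c d)
  (ℚₚ.∣p+q∣≤∣p∣+∣q∣ (a ℚ.- c) (b ℚ.- d))

∣*-*∣≤ : ∀ a b c d →
  ℚ.∣ a ℚ.* b ℚ.- c ℚ.* d ∣ ℚ.≤ ℚ.∣ a ℚ.* (b ℚ.- d) ∣ ℚ.+ ℚ.∣ d ℚ.* (a ℚ.- c) ∣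
∣*-*∣≤ a b c d = subst
  (λ p → ℚ.∣ p ∣ ℚ.≤ ℚ.∣ a ℚ.* (b ℚ.- d) ∣ ℚ.+ ℚ.∣ d ℚ.* (a ℚ.- c) ∣)
  (ℚS.solve 4 (λ a b c d →
    a ℚS.:* (b ℚS.:- d) ℚS.:+ d ℚS.:* (a ℚS.:- c) ℚS.:= a ℚS.:* b ℚS.:- c ℚS.:* d)
    refl a b c d)
  (ℚₚ.∣p+q∣≤∣p∣+∣q∣ (a ℚ.* (b ℚ.- d)) (d ℚ.* (a ℚ.- c)))

∣*∣-bound : ∀ {D η} (0<D : 0ℚ ℚ.< D) p q → ℚ.∣ p ∣ ℚ.≤ D →
            ℚ.∣ q ∣ ℚ.< inv D 0<D ℚ.* η → ℚ.∣ p ℚ.* q ∣ ℚ.< η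
∣*∣-bound {D} {η} 0<D p q p≤D q< =
  subst₂ ℚ._<_ (sym (ℚₚ.∣p*q∣≡∣p∣*∣q∣ p q)) (inv-cancel D 0<D η)
    (ℚₚ.≤-<-trans
      (ℚₚ.*-monoʳ-≤-nonNeg ℚ.∣ q ∣ {{ℚₚ.∣-∣-nonNeg q}} p≤D)
      (ℚₚ.*-monoʳ-<-pos D {{ℚ.positive 0<D}} q<))

+-<-half : ∀ {p q r ε} → p ℚ.≤ q ℚ.+ r → q ℚ.< ½ ℚ.* ε → r ℚ.< ½ ℚ.* ε → p ℚ.< ε
+-<-half {p} {ε = ε} p≤ q< r< = subst (p ℚ.<_) (half+half ε)
  (ℚₚ.≤-<-trans p≤ (ℚₚ.+-mono-< q< r<))

+-cauchy : ∀ x y → IsCauchy x → IsCauchy y → IsCauchy (λ n → x n ℚ.+ y n)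
+-cauchy x y cx cy ε 0<ε = M ℕ.⊔ N , λ i j ≤i ≤j →
  +-<-half (∣+-+∣≤ (x i) (y i) (x j) (y j))
    (proj₂ hx i j (ℕₚ.m⊔n≤o⇒m≤o M N ≤i) (ℕₚ.m⊔n≤o⇒m≤o M N ≤j))
    (proj₂ hy i j (ℕₚ.m⊔n≤o⇒n≤o M N ≤i) (ℕₚ.m⊔n≤o⇒n≤o M N ≤j))
  where
  hx = cx (½ ℚ.* ε) (half-pos 0<ε)
  hy = cy (½ ℚ.* ε) (half-pos 0<ε)
  M = proj₁ hx
  N = proj₁ hy

*-cauchy : ∀ x y → IsCauchy x → IsCauchy y → IsCauchy (λ n → x n ℚ.* y n)
*-cauchy x y cx cy ε 0<ε =
  combine (eventuallyBounded x cx) (eventuallyBounded y cy)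
  where
  combine :
    ∃[ B ] (0ℚ ℚ.< B) × (∃[ N ] (∀ n → N ℕ.≤ n → ℚ.∣ x n ∣ ℚ.≤ B)) →
    ∃[ C ] (0ℚ ℚ.< C) × (∃[ N ] (∀ n → N ℕ.≤ n → ℚ.∣ y n ∣ ℚ.≤ C)) →
    ∃[ N ] (∀ i j → N ℕ.≤ i → N ℕ.≤ j → ℚ.∣ x i ℚ.* y i ℚ.- x j ℚ.* y j ∣ ℚ.< ε)
  combine (B , 0<B , M , x≤B) (C , 0<C , N , y≤C) =
    (M ℕ.⊔ N) ℕ.⊔ (M′ ℕ.⊔ N′) , λ i j ≤i ≤j →
      +-<-half (∣*-*∣≤ (x i) (y i) (x j) (y j))
        (∣*∣-bound 0<B (x i) (y i ℚ.- y j)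
          (x≤B i (ℕₚ.m⊔n≤o⇒m≤o M N (left ≤i)))
          (proj₂ hy i j (ℕₚ.m⊔n≤o⇒n≤o M′ N′ (right ≤i)) (ℕₚ.m⊔n≤o⇒n≤o M′ N′ (right ≤j))))
        (∣*∣-bound 0<C (y j) (x i ℚ.- x j)
          (y≤C j (ℕₚ.m⊔n≤o⇒n≤o M N (left ≤j)))
          (proj₂ hx i j (ℕₚ.m⊔n≤o⇒m≤o M′ N′ (right ≤i)) (ℕₚ.m⊔n≤o⇒m≤o M′ N′ (right ≤j))))
    where
    hx = cx (inv C 0<C ℚ.* (½ ℚ.* ε)) (*-pos (inv-pos C 0<C) (half-pos 0<ε))
    hy = cy (inv B 0<B ℚ.* (½ ℚ.* ε)) (*-pos (inv-pos B 0<B) (half-pos 0<ε))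
    M′ = proj₁ hx
    N′ = proj₁ hy
    left : ∀ {i} → (M ℕ.⊔ N) ℕ.⊔ (M′ ℕ.⊔ N′) ℕ.≤ i → M ℕ.⊔ N ℕ.≤ i
    left = ℕₚ.m⊔n≤o⇒m≤o (M ℕ.⊔ N) (M′ ℕ.⊔ N′)
    right : ∀ {i} → (M ℕ.⊔ N) ℕ.⊔ (M′ ℕ.⊔ N′) ℕ.≤ i → M′ ℕ.⊔ N′ ℕ.≤ i
    right = ℕₚ.m⊔n≤o⇒n≤o (M ℕ.⊔ N) (M′ ℕ.⊔ N′)

fromℚ : ℚ → ℝ
fromℚ q = mkℝ (λ _ → q) λ ε 0<ε →
  0 , λ _ _ _ _ → subst (ℚ._< ε) (sym (cong ℚ.∣_∣ (ℚₚ.+-inverseʳ q))) 0<ε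

0ᵣ : ℝ
0ᵣ = fromℚ 0ℚ

infixl 6 _+ᵣ_
infixl 7 _*ᵣ_

_+ᵣ_ : ℝ → ℝ → ℝ
mkℝ x cx +ᵣ mkℝ y cy = mkℝ (λ n → x n ℚ.+ y n) (+-cauchy x y cx cy)

_*ᵣ_ : ℝ → ℝ → ℝ
mkℝ x cx *ᵣ mkℝ y cy = mkℝ (λ n → x n ℚ.* y n) (*-cauchy x y cx cy)

-- The reciprocal is taken along a tail on which x is bounded away from 0.
inverse : (x : ℝ) → 0ᵣ <ᵣ x → ℝ
inverse (mkℝ x cx) (ε , 0<ε , N , ε<x) = mkℝ y c
  where
  ε<tail : ∀ n → ε ℚ.< x (N ℕ.+ n)
  ε<tail n = subst (ℚ._< x (N ℕ.+ n)) (ℚₚ.+-identityˡ ε) (ε<x (N ℕ.+ n) (ℕₚ.m≤m+n N n))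

  0<tail : ∀ n → 0ℚ ℚ.< x (N ℕ.+ n)
  0<tail n = ℚₚ.<-trans 0<ε (ε<tail n)

  y : ℕ → ℚ
  y n = inv (x (N ℕ.+ n)) (0<tail n)

  εy≤1 : ∀ n → ε ℚ.* y n ℚ.≤ 1ℚ
  εy≤1 n = ℚₚ.≤-trans
    (ℚₚ.*-monoʳ-≤-nonNeg (y n)
      {{ℚ.nonNegative (ℚₚ.<⇒≤ (inv-pos (x (N ℕ.+ n)) (0<tail n)))}} (ℚₚ.<⇒≤ (ε<tail n)))
    (ℚₚ.≤-reflexive (inv-inverseʳ (x (N ℕ.+ n)) (0<tail n)))

  diff : ∀ a b (0<a : 0ℚ ℚ.< a) (0<b : 0ℚ ℚ.< b) →
         inv a 0<a ℚ.- inv b 0<b ≡ inv a 0<a ℚ.* inv b 0<b ℚ.* (b ℚ.- a)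
  diff a b 0<a 0<b = trans
    (cong₂ ℚ._-_
      (trans (sym (ℚₚ.*-identityʳ a⁻¹)) (cong (a⁻¹ ℚ.*_) (sym (inv-inverseʳ b 0<b))))
      (trans (sym (ℚₚ.*-identityʳ b⁻¹)) (cong (b⁻¹ ℚ.*_) (sym (inv-inverseʳ a 0<a)))))
    (ℚS.solve 4 (λ p q a b →
      p ℚS.:* (b ℚS.:* q) ℚS.:- q ℚS.:* (a ℚS.:* p) ℚS.:= p ℚS.:* q ℚS.:* (b ℚS.:- a))
      refl a⁻¹ b⁻¹ a b)
    where
    a⁻¹ = inv a 0<a
    b⁻¹ = inv b 0<b

  c : IsCauchy y
  c η 0<η with cx (ε ℚ.* ε ℚ.* η) (*-pos (*-pos 0<ε 0<ε) 0<η)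
  ... | M , hx = M , λ i j M≤i M≤j →
    let yi = inv-pos (x (N ℕ.+ i)) (0<tail i)
        yj = inv-pos (x (N ℕ.+ j)) (0<tail j)
        d  = hx (N ℕ.+ j) (N ℕ.+ i)
               (ℕₚ.≤-trans M≤j (ℕₚ.m≤n+m j N)) (ℕₚ.≤-trans M≤i (ℕₚ.m≤n+m i N))
        yy = *-pos yi yj
        0≤εy : ∀ {n} → 0ℚ ℚ.< y n → 0ℚ ℚ.≤ ε ℚ.* y n
        0≤εy 0<y = ℚₚ.<⇒≤ (*-pos 0<ε 0<y)
        step₁ = ℚₚ.*-monoʳ-<-pos (y i ℚ.* y j) {{ℚ.positive yy}} d
        step₂ = ℚₚ.*-monoʳ-≤-nonNeg η {{ℚ.nonNegative (ℚₚ.<⇒≤ 0<η)}}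
                  (*-mono-≤-nonNeg (0≤εy {i} yi) (ℚₚ.<⇒≤ (ℚₚ.positive⁻¹ 1ℚ)) (εy≤1 i) (εy≤1 j))
    in subst₂ ℚ._<_
         (sym (trans (cong ℚ.∣_∣ (diff (x (N ℕ.+ i)) (x (N ℕ.+ j)) (0<tail i) (0<tail j)))
           (trans (ℚₚ.∣p*q∣≡∣p∣*∣q∣ (y i ℚ.* y j) (x (N ℕ.+ j) ℚ.- x (N ℕ.+ i)))
             (cong (ℚ._* ℚ.∣ x (N ℕ.+ j) ℚ.- x (N ℕ.+ i) ∣) (ℚₚ.0≤p⇒∣p∣≡p (ℚₚ.<⇒≤ yy))))))
         (ℚₚ.*-identityˡ η)
         (ℚₚ.<-≤-trans step₁
           (ℚₚ.≤-trans
             (ℚₚ.≤-reflexive (ℚS.solve 4 (λ p q e h →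
               p ℚS.:* q ℚS.:* (e ℚS.:* e ℚS.:* h) ℚS.:= e ℚS.:* p ℚS.:* (e ℚS.:* q) ℚS.:* h)
               refl (y i) (y j) ε η))
             step₂))

⌊√_⌋ : ℕ → ℕ
⌊√ zero ⌋  = 0
⌊√ suc m ⌋ with suc ⌊√ m ⌋ ℕ.* suc ⌊√ m ⌋ ℕ.≤? suc m
... | yes _ = suc ⌊√ m ⌋
... | no  _ = ⌊√ m ⌋

⌊√⌋-lower : ∀ m → ⌊√ m ⌋ ℕ.* ⌊√ m ⌋ ℕ.≤ m
⌊√⌋-lower zero = ℕ.z≤n
⌊√⌋-lower (suc m) with suc ⌊√ m ⌋ ℕ.* suc ⌊√ m ⌋ ℕ.≤? suc m
... | yes p = p
... | no  _ = ℕₚ.m≤n⇒m≤1+n (⌊√⌋-lower m)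

⌊√⌋-upper : ∀ m → m ℕ.< suc ⌊√ m ⌋ ℕ.* suc ⌊√ m ⌋
⌊√⌋-upper zero = ℕ.s≤s ℕ.z≤n
⌊√⌋-upper (suc m) with suc ⌊√ m ⌋ ℕ.* suc ⌊√ m ⌋ ℕ.≤? suc m
... | yes _ = ℕₚ.≤-<-trans (⌊√⌋-upper m)
  (ℕₚ.*-mono-< (ℕₚ.n<1+n (suc ⌊√ m ⌋)) (ℕₚ.n<1+n (suc ⌊√ m ⌋)))
... | no ¬p = ℕₚ.≰⇒> ¬p

√-seq : ℕ → ℕ → ℚ
√-seq m n = ℤ.+ ⌊√ m ℕ.* (suc n ℕ.* suc n) ⌋ ℚ./ suc n

/-mono-< : ∀ a b i j → a ℕ.* suc j ℕ.< b ℕ.* suc i →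
           ℤ.+ a ℚ./ suc i ℚ.< ℤ.+ b ℚ./ suc j
/-mono-< a b i j p = ℚₚ.toℚᵘ-cancel-<
  (ℚᵘₚ.<-respˡ-≃ (ℚᵘₚ.≃-sym (ℚₚ.toℚᵘ-fromℚᵘ (ℚᵘ.mkℚᵘ (ℤ.+ a) i)))
  (ℚᵘₚ.<-respʳ-≃ (ℚᵘₚ.≃-sym (ℚₚ.toℚᵘ-fromℚᵘ (ℚᵘ.mkℚᵘ (ℤ.+ b) j)))
    (ℚᵘ.*<* (subst₂ ℤ._<_ (ℤₚ.pos-* a (suc j)) (ℤₚ.pos-* b (suc i)) (ℤ.+<+ p)))))

+1/ : ∀ a j → ℤ.+ suc a ℚ./ suc j ≡ ℤ.+ a ℚ./ suc j ℚ.+ ℤ.+ 1 ℚ./ suc j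
+1/ a j = ℚₚ.toℚᵘ-injective (ℚᵘₚ.≃-trans (ℚₚ.toℚᵘ-fromℚᵘ (ℚᵘ.mkℚᵘ (ℤ.+ suc a) j))
  (ℚᵘₚ.≃-sym (ℚᵘₚ.≃-trans (ℚₚ.toℚᵘ-homo-+ (ℤ.+ a ℚ./ suc j) (ℤ.+ 1 ℚ./ suc j))
    (ℚᵘₚ.≃-trans
      (ℚᵘₚ.+-cong (ℚₚ.toℚᵘ-fromℚᵘ (ℚᵘ.mkℚᵘ (ℤ.+ a) j)) (ℚₚ.toℚᵘ-fromℚᵘ (ℚᵘ.mkℚᵘ (ℤ.+ 1) j)))
      (ℚᵘ.*≡* lemma)))))
  where
  J = suc j
  lemma : (ℤ.+ a ℤ.* ℤ.+ J ℤ.+ ℤ.+ 1 ℤ.* ℤ.+ J) ℤ.* ℤ.+ J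
        ≡ ℤ.+ suc a ℤ.* (ℤ.+ J ℤ.* ℤ.+ J)
  lemma = trans
    (cong (ℤ._* ℤ.+ J) (trans (sym (ℤₚ.*-distribʳ-+ (ℤ.+ J) (ℤ.+ a) (ℤ.+ 1)))
      (cong (λ k → ℤ.+ k ℤ.* ℤ.+ J) (ℕₚ.+-comm a 1))))
    (ℤₚ.*-assoc (ℤ.+ suc a) (ℤ.+ J) (ℤ.+ J))

-- (aJ)² ≤ mI²J² < ((b + 1)I)²
√-seq-close : ∀ m i j → √-seq m i ℚ.< √-seq m j ℚ.+ ℤ.+ 1 ℚ./ suc j
√-seq-close m i j = subst (√-seq m i ℚ.<_) (+1/ b j) (/-mono-< a (suc b) i j aJ<1+bI)
  where
  I = suc i
  J = suc j
  a = ⌊√ m ℕ.* (I ℕ.* I) ⌋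
  b = ⌊√ m ℕ.* (J ℕ.* J) ⌋

  rearrange : ∀ p q → p ℕ.* q ℕ.* (p ℕ.* q) ≡ p ℕ.* p ℕ.* (q ℕ.* q)
  rearrange = ℕS.solve 2 (λ p q →
    p ℕS.:* q ℕS.:* (p ℕS.:* q) ℕS.:= p ℕS.:* p ℕS.:* (q ℕS.:* q)) refl

  swap : ∀ m p q → m ℕ.* p ℕ.* q ≡ m ℕ.* q ℕ.* p
  swap = ℕS.solve 3 (λ m p q → m ℕS.:* p ℕS.:* q ℕS.:= m ℕS.:* q ℕS.:* p) refl

  squares : a ℕ.* J ℕ.* (a ℕ.* J) ℕ.< suc b ℕ.* I ℕ.* (suc b ℕ.* I)
  squares = subst₂ ℕ._<_ (sym (rearrange a J)) (sym (rearrange (suc b) I))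
    (ℕₚ.≤-<-trans
      (ℕₚ.*-monoˡ-≤ (J ℕ.* J) (⌊√⌋-lower (m ℕ.* (I ℕ.* I))))
      (ℕₚ.≤-<-trans (ℕₚ.≤-reflexive (swap m (I ℕ.* I) (J ℕ.* J)))
        (ℕₚ.*-monoˡ-< (I ℕ.* I) (⌊√⌋-upper (m ℕ.* (J ℕ.* J))))))

  aJ<1+bI : a ℕ.* J ℕ.< suc b ℕ.* I
  aJ<1+bI with a ℕ.* J ℕ.<? suc b ℕ.* I
  ... | yes p = p
  ... | no ¬p = ⊥-elim (ℕₚ.<⇒≱ squares (ℕₚ.*-mono-≤ (ℕₚ.≮⇒≥ ¬p) (ℕₚ.≮⇒≥ ¬p)))

archimedean : ∀ ε → 0ℚ ℚ.< ε → ∃[ N ] (∀ n → N ℕ.≤ n → ℤ.+ 1 ℚ./ suc n ℚ.< ε)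
archimedean ε 0<ε with ε in eq | ℚ.positive 0<ε
... | ℚ.mkℚ (ℤ.+ suc p) q c | _ = suc q , λ n q<n →
  subst (ℤ.+ 1 ℚ./ suc n ℚ.<_) (ℚₚ.fromℚᵘ-toℚᵘ (ℚ.mkℚ (ℤ.+ suc p) q c))
    (/-mono-< 1 (suc p) n q
      (subst (ℕ._< suc p ℕ.* suc n) (sym (ℕₚ.*-identityˡ (suc q)))
        (ℕₚ.<-≤-trans (ℕ.s≤s q<n) (ℕₚ.m≤n*m (suc n) (suc p)))))

∣-∣-< : ∀ p q {ε} → p ℚ.< q ℚ.+ ε → q ℚ.< p ℚ.+ ε → ℚ.∣ p ℚ.- q ∣ ℚ.< ε
∣-∣-< p q {ε} p< q< with ℚₚ.∣p∣≡p∨∣p∣≡-p (p ℚ.- q)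
... | inj₁ e = subst₂ ℚ._<_ (sym e)
  (ℚS.solve 2 (λ q ε → (q ℚS.:+ ε) ℚS.:- q ℚS.:= ε) refl q ε)
  (ℚₚ.+-monoˡ-< (ℚ.- q) p<)
... | inj₂ e = subst₂ ℚ._<_
  (trans (ℚS.solve 2 (λ p q → q ℚS.:- p ℚS.:= ℚS.:- (p ℚS.:- q)) refl p q) (sym e))
  (ℚS.solve 2 (λ p ε → (p ℚS.:+ ε) ℚS.:- p ℚS.:= ε) refl p ε)
  (ℚₚ.+-monoˡ-< (ℚ.- p) q<)

-- √ m is the limit of ⌊(n + 1) √m⌋ / (n + 1).
√_ : ℕ → ℝ
√ m = mkℝ (√-seq m) c
  where
  c : IsCauchy (√-seq m)
  c ε 0<ε with archimedean ε 0<ε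
  ... | N , small = N , λ i j N≤i N≤j → ∣-∣-< (√-seq m i) (√-seq m j)
    (ℚₚ.<-trans (√-seq-close m i j) (ℚₚ.+-monoʳ-< (√-seq m j) (small j N≤j)))
    (ℚₚ.<-trans (√-seq-close m j i) (ℚₚ.+-monoʳ-< (√-seq m i) (small i N≤i)))

[3+√5]/2 : ℝ
[3+√5]/2 = (fromℚ (ℤ.+ 3 ℚ./ 1) +ᵣ √ 5) *ᵣ fromℚ ½

------------------------------------------------------------------------
-- Instances

-- Equality on 𝒰 is decidable so that finite subsets of 𝒰 have weights.
record Instance : Set₁ where
  field
    𝒰        : Set
    _≟_      : DecidableEquality 𝒰
    ν        : 𝒰 → ℝ
    ν-nonNeg : ∀ u → 0ᵣ ≤ᵣ ν u

  Ω : Set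
  Ω = 𝒰 × ℕ

  -- Finite subsets of Ω are represented by lists without repetition.

  f : List Ω → ℝ
  f S = foldr _+ᵣ_ 0ᵣ (map ν (deduplicate _≟_ (map proj₁ S)))

  ∣_∩Ω_∣ : List Ω → ℕ → ℕ
  ∣ S ∩Ω i ∣ = length (filter (λ x → proj₂ x ℕ.≟ i) S)

  Independent : List Ω → Set
  Independent S = ∀ i → ∣ S ∩Ω i ∣ ℕ.≤ 1

  independent? : ∀ S → Dec (Independent S)
  independent? S with All.all? (λ x → ∣ S ∩Ω proj₂ x ∣ ℕ.≤? 1) S
  ... | no ¬h = no λ ind → ¬h (All.universal (λ x → ind (proj₂ x)) S)
  ... | yes h = yes λ i → bound i (Any.any? (λ x → proj₂ x ℕ.≟ i) S)
    where
    bound : ∀ i → Dec (Any (λ x → proj₂ x ≡ i) S) → ∣ S ∩Ω i ∣ ℕ.≤ 1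
    bound i (yes p) = let (b , j≡i) = All.lookupAny h p in
      subst (λ j → ∣ S ∩Ω j ∣ ℕ.≤ 1) j≡i b
    bound i (no ¬p) = subst (λ T → length T ℕ.≤ 1)
      (sym (filter-none (λ x → proj₂ x ℕ.≟ i) (¬Any⇒All¬ S ¬p))) ℕ.z≤n

------------------------------------------------------------------------
-- Online algorithms

-- A sequence of n arrivals is a vector with the latest arrival at its
-- head.  A set of arrived elements is a Subset n of positions, and the
-- algorithm has no other access to the elements.

select : ∀ {A : Set} {n} → Vec A n → Subset n → List A
select []      []            = []
select (x ∷ σ) (inside  ∷ S) = x ∷ select σ S
select (x ∷ σ) (outside ∷ S) = select σ S

ValueOracle IndependenceOracle : ℕ → Set
ValueOracle        n = Subset n → ℝ
IndependenceOracle n = Subset n → Bool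

-- The arguments are the oracles on the n + 1 elements that have arrived
-- and the set maintained before the last arrival; the answers of the
-- oracles at earlier times are those on subsets without the latest
-- positions.  Real numbers being compared by _≃ᵣ_, a decision is a
-- function of oracle values only if it respects _≃ᵣ_.
record Algorithm : Set where
  field
    keep   : ∀ {n} → ValueOracle (suc n) → IndependenceOracle (suc n) →
             Subset n → Subset n
    accept : ∀ {n} → ValueOracle (suc n) → IndependenceOracle (suc n) →
             Subset n → Bool

    keep-cong   : ∀ {n} {v v′ : ValueOracle (suc n)} {ι ι′ : IndependenceOracle (suc n)} →
                  (∀ T → v T ≃ᵣ v′ T) → (∀ T → ι T ≡ ι′ T) →
                  ∀ S → keep v ι S ≡ keep v′ ι′ S
    accept-cong : ∀ {n} {v v′ : ValueOracle (suc n)} {ι ι′ : IndependenceOracle (suc n)} →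
                  (∀ T → v T ≃ᵣ v′ T) → (∀ T → ι T ≡ ι′ T) →
                  ∀ S → accept v ι S ≡ accept v′ ι′ S

module _ (I : Instance) where
  open Instance I

  valueOracle : ∀ {n} → Vec Ω n → ValueOracle n
  valueOracle σ T = f (select σ T)

  independenceOracle : ∀ {n} → Vec Ω n → IndependenceOracle n
  independenceOracle σ T = does (independent? (select σ T))

  -- Intersecting with the previous set makes removals irrevocable.
  run : Algorithm → ∀ {n} → Vec Ω n → Subset n
  run A []      = []
  run A (e ∷ σ) = accept v ι S ∷ (keep v ι S ∩ S)
    where
    open Algorithm A
    v = valueOracle (e ∷ σ)
    ι = independenceOracle (e ∷ σ)
    S = run A σ

  IsOptimal : ∀ {n} → Vec Ω n → Subset n → Set
  IsOptimal σ T = Independent (select σ T) ×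
    (∀ T′ → Independent (select σ T′) → f (select σ T′) ≤ᵣ f (select σ T))

MaintainsIndependence : Algorithm → Set₁
MaintainsIndependence A = ∀ I → let open Instance I in
  ∀ {n} (σ : Vec Ω n) → Unique σ → Independent (select σ (run I A σ))

HasCompetitiveRatio : Algorithm → ℝ → Set₁
HasCompetitiveRatio A r = ∀ I → let open Instance I in
  ∀ {n} (σ : Vec Ω n) → Unique σ → ∀ OPT → IsOptimal I σ OPT →
  r *ᵣ f (select σ OPT) ≤ᵣ f (select σ (run I A σ))

{-# OPTIONS --safe #-}
module Submission where

-- All weights live in one fixed instance, so that the adversary only has to choose, from the
-- decisions seen so far, which element arrives next.  Write a for a rational with α ≤ a (from
-- some index on) and a² + 1 < 3a; it exists because α < (3 + √5)/2 (rationalBound).  It is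
-- enough to reach a moment at which a times the weight held by the algorithm is at most the
-- weight of some independent set of arrived elements: as r > 1/α, the competitive ratio r then
-- fails (exceeds, competitor).
--
-- The items are, for every n, two twins of weight x n and one bait of weight y n.  At the start
-- of round n both twins n have been offered at slot 0, and the algorithm holds at most one of
-- them, m, there, together with baits of earlier rounds.  Apart from m, a matching contains the
-- other twin at slot 0 and, at other slots, items of total weight Z n: the earlier baits and one
-- twin of each earlier round.  With Y n the total weight of the earlier baits, let
--   slack n = a (x n + Y n) - (2 x n + Z n).
-- If slack n ≤ 0, the arrival of m at a new slot s₁ adds m to the matching and the algorithm
-- has lost.  Otherwise m arrives at s₁, which the algorithm may well use for a second copy of m,
-- and then
--   * the bait n, of weight y n = slack n, arrives at s₁.  If it is rejected, m is offered at
--     another new slot s₂, and the matching gains both m and the bait: the algorithm has lost.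
--     If it is accepted, the second copy of m is gone, and the bait is offered at s₂;
--   * a twin n + 1, of weight x n + a y n, arrives at slot 0.  If it is rejected, it takes slot 0
--     in the matching, with m at s₁ and the bait at s₂: the algorithm has lost.  If it is
--     accepted, m is lost although it can be matched at s₁;
--   * the other twin n + 1 arrives at slot 0.  The algorithm keeps at most one of the two there,
--     the other one takes slot 0 in the matching, and round n + 1 begins.
--
-- While the slack is positive, (x , slack) evolves by the linear map
--   x ↦ x + a slack,   slack ↦ a (a - 1) slack - x,
-- of trace a² - a + 1 and determinant a².  The discriminant (a² - 3a + 1)(a² + a + 1) is
-- negative, so the map is conjugate to a rotation followed by a scaling, and the slack cannot
-- stay positive.  In elementary terms, slack n / x n is a - 2 for n = 0 and drops in each round
-- of positive slack by at least the constant (3a - 1 - a²)/3 (descent, exhausted).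

open import Defs
open import Data.Bool as Bool using (Bool; true; false; not)
open import Data.Bool.Properties using (not-¬)
open import Data.Empty using (⊥; ⊥-elim)
open import Data.Fin.Subset using (Subset; inside; outside; _∩_)
import Data.Integer as ℤ
import Data.Integer.Properties as ℤₚ
open import Data.List using (List; []; _∷_; map; foldr; filter; length; deduplicate; _++_)
open import Data.List.Membership.Propositional using (_∈_)
open import Data.List.Membership.Propositional.Properties
  using (∈-∃++; ∈-deduplicate⁻; ∈-++⁻; ∈-++⁺ˡ; ∈-++⁺ʳ)
open import Data.List.Properties using (filter-none; filter-all; filter-accept; filter-reject)
open import Data.List.Relation.Unary.All as All using (All; []; _∷_)
import Data.List.Relation.Unary.All.Properties as Allₚ
open import Data.List.Relation.Unary.AllPairs using (AllPairs; []; _∷_)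
open import Data.List.Relation.Unary.Any using (here; there)
open import Data.List.Relation.Unary.Unique.DecPropositional.Properties using (deduplicate-!)
import Data.List.Relation.Unary.Unique.Propositional as List
open import Data.Nat as ℕ using (ℕ; zero; suc; z≤n; s≤s)
import Data.Nat.Properties as ℕₚ
open import Data.Product using (_×_; ∃-syntax; _,_; proj₁; proj₂)
open import Data.Rational as ℚ
  using (ℚ; 0ℚ; 1ℚ; ½; _+_; _*_; _-_; -_; _≤_; _<_; _⊔_; _⊓_)
import Data.Rational.Properties as ℚₚ
import Data.Rational.Unnormalised as ℚᵘ
import Data.Rational.Unnormalised.Properties as ℚᵘₚ
open import Data.Sum using (_⊎_; inj₁; inj₂; [_,_]′)
open import Data.Vec using (Vec; []; _∷_)
open import Data.Vec.Relation.Unary.All as VAll using ([]; _∷_)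
open import Data.Vec.Relation.Unary.AllPairs using ([]; _∷_)
open import Data.Vec.Relation.Unary.Unique.Propositional using (Unique)
open import Relation.Binary.Definitions using (DecidableEquality)
open import Relation.Binary.PropositionalEquality
  using (_≡_; _≢_; refl; sym; trans; cong; cong₂; subst; subst₂)
open import Relation.Nullary using (¬_; Dec; yes; no)

open ℚS using (con; _:=_; _:+_; _:*_; _:-_)

------------------------------------------------------------------------
-- Order on the rationals

≤-by : ∀ {p q} r → q ≡ p + r → 0ℚ ≤ r → p ≤ q
≤-by {p} r refl 0≤r = subst (_≤ p + r) (ℚₚ.+-identityʳ p) (ℚₚ.+-monoʳ-≤ p 0≤r)

≤⇒0≤- : ∀ {p q} → p ≤ q → 0ℚ ≤ q - p
≤⇒0≤- {p} {q} p≤q = subst (_≤ q - p) (ℚₚ.+-inverseʳ p) (ℚₚ.+-monoˡ-≤ (- p) p≤q)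

+-nonNeg : ∀ {p q} → 0ℚ ≤ p → 0ℚ ≤ q → 0ℚ ≤ p + q
+-nonNeg = ℚₚ.+-mono-≤

*-nonNeg : ∀ {p q} → 0ℚ ≤ p → 0ℚ ≤ q → 0ℚ ≤ p * q
*-nonNeg {p} {q} 0≤p 0≤q = subst (_≤ p * q) (ℚₚ.*-zeroʳ p)
  (ℚₚ.*-monoˡ-≤-nonNeg p {{ℚ.nonNegative 0≤p}} 0≤q)

0≤1 : 0ℚ ≤ 1ℚ
0≤1 = ℚₚ.<⇒≤ (ℚₚ.positive⁻¹ 1ℚ)

<⇒≱ : ∀ {p q} → p < q → ¬ (q ≤ p)
<⇒≱ p<q q≤p = ℚₚ.<-irrefl refl (ℚₚ.<-≤-trans p<q q≤p)

p≤∣p∣ : ∀ p → p ≤ ℚ.∣ p ∣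
p≤∣p∣ p with ℚₚ.≤-total p 0ℚ
... | inj₁ p≤0 = ℚₚ.≤-trans p≤0 (ℚₚ.0≤∣p∣ p)
... | inj₂ 0≤p = ℚₚ.≤-reflexive (sym (ℚₚ.0≤p⇒∣p∣≡p 0≤p))

⊓-pos : ∀ {p q} → 0ℚ < p → 0ℚ < q → 0ℚ < p ⊓ q
⊓-pos {p} {q} 0<p 0<q with ℚₚ.⊓-sel p q
... | inj₁ eq = subst (0ℚ <_) (sym eq) 0<p
... | inj₂ eq = subst (0ℚ <_) (sym eq) 0<q

2ℚ 3ℚ ⅓ : ℚ
2ℚ = ℤ.+ 2 ℚ./ 1
3ℚ = ℤ.+ 3 ℚ./ 1
⅓  = ℤ.+ 1 ℚ./ 3

-- The sum of n copies of q.
multiple : ℕ → ℚ → ℚ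
multiple zero    q = 0ℚ
multiple (suc n) q = q + multiple n q

multiple-unbounded : ∀ q → 0ℚ < q → ∃[ n ] 1ℚ ≤ multiple n q
multiple-unbounded q 0<q with archimedean q 0<q
... | N , small = 2 ℕ.* suc N , ℚₚ.≤-trans (ℚₚ.<⇒≤ 1<2) (≤multiple (2 ℕ.* suc N))
  where
  ≤multiple : ∀ a → ℤ.+ a ℚ./ suc N ≤ multiple a q
  ≤multiple zero    = ℚₚ.≤-reflexive (ℚₚ.0/n≡0 (suc N))
  ≤multiple (suc a) = subst (_≤ multiple (suc a) q)
    (trans (ℚₚ.+-comm (ℤ.+ 1 ℚ./ suc N) (ℤ.+ a ℚ./ suc N)) (sym (+1/ a N)))
    (ℚₚ.+-mono-≤ (ℚₚ.<⇒≤ (small N ℕₚ.≤-refl)) (≤multiple a))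

  1<2 : 1ℚ < ℤ.+ (2 ℕ.* suc N) ℚ./ suc N
  1<2 = /-mono-< 1 (2 ℕ.* suc N) 0 N (subst (1 ℕ.* suc N ℕ.<_)
    (sym (ℕₚ.*-identityʳ (2 ℕ.* suc N))) (ℕₚ.*-monoˡ-< (suc N) (ℕₚ.n<1+n 1)))

------------------------------------------------------------------------
-- Rational bounds for α and r

-- margin a = (3a - 1 - a²)/3 is positive exactly when a lies strictly between the roots
-- (3 ± √5)/2 of a² - 3a + 1.
margin : ℚ → ℚ
margin a = ⅓ * (3ℚ * a - 1ℚ - a * a)

0<margin⇒≤3 : ∀ {a} → 0ℚ ≤ a → 0ℚ < margin a → a ≤ 3ℚ
0<margin⇒≤3 {a} 0≤a 0<μ = ℚₚ.≮⇒≥ λ 3<a → <⇒≱ 0<μ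
  (≤-by {margin a} {0ℚ} (⅓ * (1ℚ + a * (a - 3ℚ)))
    (ℚS.solve 1 (λ a → con 0ℚ := con ⅓ :* (con 3ℚ :* a :- con 1ℚ :- a :* a)
      :+ con ⅓ :* (con 1ℚ :+ a :* (a :- con 3ℚ))) refl a)
    (*-nonNeg (ℚₚ.<⇒≤ (ℚₚ.positive⁻¹ ⅓)) (+-nonNeg 0≤1 (*-nonNeg 0≤a (≤⇒0≤- (ℚₚ.<⇒≤ 3<a))))))

√-seq²≤ : ∀ m n → √-seq m n * √-seq m n ≤ ℤ.+ m ℚ./ 1
√-seq²≤ m n = ℚₚ.toℚᵘ-cancel-≤
  (ℚᵘₚ.≤-respˡ-≃ (ℚᵘₚ.≃-sym (ℚᵘₚ.≃-trans (ℚₚ.toℚᵘ-homo-* (√-seq m n) (√-seq m n))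
    (ℚᵘₚ.*-cong (ℚₚ.toℚᵘ-fromℚᵘ t/n) (ℚₚ.toℚᵘ-fromℚᵘ t/n))))
  (ℚᵘₚ.≤-respʳ-≃ (ℚᵘₚ.≃-sym (ℚₚ.toℚᵘ-fromℚᵘ (ℚᵘ.mkℚᵘ (ℤ.+ m) 0)))
    (ℚᵘ.*≤* (subst₂ ℤ._≤_ lhs (ℤₚ.pos-* m (suc n ℕ.* suc n))
      (ℤ.+≤+ (⌊√⌋-lower (m ℕ.* (suc n ℕ.* suc n))))))))
  where
  t = ⌊√ m ℕ.* (suc n ℕ.* suc n) ⌋
  t/n = ℚᵘ.mkℚᵘ (ℤ.+ t) n

  lhs : ℤ.+ (t ℕ.* t) ≡ ℤ.+ t ℤ.* ℤ.+ t ℤ.* ℤ.+ 1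
  lhs = trans (ℤₚ.pos-* t t) (sym (ℤₚ.*-identityʳ (ℤ.+ t ℤ.* ℤ.+ t)))

½<√-seq : ∀ n → ½ < √-seq 5 n
½<√-seq n = /-mono-< 1 t 1 n
  (subst (ℕ._< t ℕ.* 2) (sym (ℕₚ.*-identityˡ (suc n)))
    (subst (suc n ℕ.<_) (ℕₚ.*-comm 2 t)
      (ℕₚ.<-≤-trans (ℕₚ.m<m+n (suc n) (ℕ.s≤s ℕ.z≤n))
        (ℕₚ.+-mono-≤ n≤t (ℕₚ.≤-trans n≤t (ℕₚ.m≤m+n t 0))))))
  where
  N = suc n
  t = ⌊√ 5 ℕ.* (N ℕ.* N) ⌋

  n≤t : N ℕ.≤ t
  n≤t with N ℕ.≤? t
  ... | yes p = p
  ... | no ¬p = ⊥-elim (ℕₚ.<⇒≱ (⌊√⌋-upper (5 ℕ.* (N ℕ.* N)))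
    (ℕₚ.≤-trans (ℕₚ.*-mono-≤ (ℕₚ.≰⇒> ¬p) (ℕₚ.≰⇒> ¬p)) (ℕₚ.m≤n*m (N ℕ.* N) 5)))

-- With a = (3 + s)/2 - e, the margin is (e (s - e))/3 + (5 - s²)/12.
0<margin-near : ∀ s e → s * s ≤ ℤ.+ 5 ℚ./ 1 → ½ < s → 0ℚ < e → e ≤ ½ →
                0ℚ < margin ((3ℚ + s) * ½ - e)
0<margin-near s e s²≤5 ½<s 0<e e≤½ = subst (0ℚ <_)
  (ℚS.solve 2 (λ s e → let a = (con 3ℚ :+ s) :* con ½ :- e in
     e :* ((s :- e) :* con ⅓) :+ (con (ℤ.+ 5 ℚ./ 1) :- s :* s) :* con (ℤ.+ 1 ℚ./ 12)
      := con ⅓ :* (con 3ℚ :* a :- con 1ℚ :- a :* a)) refl s e)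
  (ℚₚ.+-mono-<-≤ (*-pos 0<e (*-pos 0<s-e (ℚₚ.positive⁻¹ ⅓)))
    (*-nonNeg (≤⇒0≤- s²≤5) (ℚₚ.<⇒≤ (ℚₚ.positive⁻¹ (ℤ.+ 1 ℚ./ 12)))))
  where
  0<s-e : 0ℚ < s - e
  0<s-e = subst (_< s - e) (ℚₚ.+-inverseʳ e) (ℚₚ.+-monoˡ-< (- e) (ℚₚ.≤-<-trans e≤½ ½<s))

-- The sequence of √ 5 consists of lower approximations s, so (3 + s)/2 is at most (3 + √5)/2,
-- and subtracting a small e leaves room for a strict inequality.
rationalBound : ∀ α → 0ᵣ <ᵣ α → α <ᵣ [3+√5]/2 →
  ∃[ a ] 0ℚ ≤ a × 0ℚ < margin a × (∃[ N ] (∀ n → N ℕ.≤ n → seq α n ≤ a))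
rationalBound α (η , 0<η , K , η<α) (ε , 0<ε , M , α+ε<c) =
  a , ℚₚ.≤-trans (ℚₚ.<⇒≤ 0<α) (α≤a (K ℕ.+ P) (ℕₚ.m≤n+m P K)) ,
  0<margin-near s e (√-seq²≤ 5 P) (½<√-seq P) 0<e (ℚₚ.p⊓q≤q (½ * ε) ½) , P , α≤a
  where
  c = seq [3+√5]/2
  -- The bound ½ keeps a above the smaller root of a² - 3a + 1.
  e = (½ * ε) ⊓ ½

  0<e : 0ℚ < e
  0<e = ⊓-pos (half-pos 0<ε) (ℚₚ.positive⁻¹ ½)

  L = proj₁ (cauchy [3+√5]/2 (½ * ε) (half-pos 0<ε))
  P = M ℕ.⊔ L
  s = √-seq 5 P
  a = c P - e

  0<α : 0ℚ < seq α (K ℕ.+ P)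
  0<α = ℚₚ.<-trans 0<η (subst (_< seq α (K ℕ.+ P)) (ℚₚ.+-identityˡ η)
    (η<α (K ℕ.+ P) (ℕₚ.m≤m+n K P)))

  α≤a : ∀ n → P ℕ.≤ n → seq α n ≤ a
  α≤a n P≤n = ℚₚ.≤-trans α≤ (ℚₚ.+-monoʳ-≤ (c P) (ℚₚ.neg-antimono-≤ (ℚₚ.p⊓q≤p (½ * ε) ½)))
    where
    c< : c n - c P < ½ * ε
    c< = ℚₚ.≤-<-trans (p≤∣p∣ (c n - c P))
      (proj₂ (cauchy [3+√5]/2 (½ * ε) (half-pos 0<ε)) n P
        (ℕₚ.≤-trans (ℕₚ.m≤n⊔m M L) P≤n) (ℕₚ.m≤n⊔m M L))

    α≤ : seq α n ≤ c P - ½ * ε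
    α≤ = ≤-by ((c n - (seq α n + ε)) + (½ * ε - (c n - c P)))
      (ℚS.solve 4 (λ α c p h →
        p :- con ½ :* h := α :+ ((c :- (α :+ h)) :+ (con ½ :* h :- (c :- p))))
        refl (seq α n) (c n) (c P) ε)
      (+-nonNeg (≤⇒0≤- (ℚₚ.<⇒≤ (α+ε<c n (ℕₚ.≤-trans (ℕₚ.m≤m⊔n M L) P≤n))))
        (≤⇒0≤- (ℚₚ.<⇒≤ c<)))

-- If a h ≤ o for some a ≥ α, then h ≤ o / α < r o, along the sequence of r with a gap ε that
-- does not depend on the index.
exceeds : ∀ {α r a} (0<α : 0ᵣ <ᵣ α) → inverse α 0<α <ᵣ r →
  ∃[ N ] (∀ n → N ℕ.≤ n → seq α n ≤ a) → ∀ {h o} → 0ℚ ≤ h → 0ℚ < o → a * h ≤ o →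
  ∃[ ε ] (0ℚ < ε) × (∃[ N ] (∀ n → N ℕ.≤ n → h + ε < seq r n * o))
exceeds {α} {r} {a} 0<α@(η , 0<η , K , η<α) (ε , 0<ε , M , inv+ε<r) (N , α≤a)
  {h} {o} 0≤h 0<o ah≤o =
  ε * o , *-pos 0<ε 0<o , M ℕ.⊔ N , λ n ≤n → ℚₚ.≤-<-trans (bound n (ℕₚ.m⊔n≤o⇒n≤o M N ≤n))
    (ℚₚ.*-monoˡ-<-pos o {{ℚ.positive 0<o}} (inv+ε<r n (ℕₚ.m⊔n≤o⇒m≤o M N ≤n)))
  where
  bound : ∀ n → N ℕ.≤ n → h + ε * o ≤ (seq (inverse α 0<α) n + ε) * o
  bound n N≤n = subst (h + ε * o ≤_) (sym (ℚₚ.*-distribʳ-+ o p ε))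
    (ℚₚ.+-monoˡ-≤ (ε * o)
      (ℚₚ.≤-trans h≤pah (ℚₚ.*-monoˡ-≤-nonNeg p {{ℚ.nonNegative 0≤p}} ah≤o)))
    where
    p = seq (inverse α 0<α) n

    0<αₙ : 0ℚ < seq α (K ℕ.+ n)
    0<αₙ = ℚₚ.<-trans 0<η (subst (_< seq α (K ℕ.+ n)) (ℚₚ.+-identityˡ η)
      (η<α (K ℕ.+ n) (ℕₚ.m≤m+n K n)))

    0≤p : 0ℚ ≤ p
    0≤p = ℚₚ.<⇒≤ (inv-pos (seq α (K ℕ.+ n)) 0<αₙ)

    αp≡1 : seq α (K ℕ.+ n) * p ≡ 1ℚ
    αp≡1 = inv-inverseʳ (seq α (K ℕ.+ n)) 0<αₙ

    h≤pah : h ≤ p * (a * h)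
    h≤pah = ≤-by (p * ((a - seq α (K ℕ.+ n)) * h))
      (trans (ℚS.solve 4 (λ p a α h → p :* (a :* h) := α :* p :* h :+ p :* ((a :- α) :* h))
        refl p a (seq α (K ℕ.+ n)) h)
        (cong (_+ p * ((a - seq α (K ℕ.+ n)) * h))
          (trans (cong (_* h) αp≡1) (ℚₚ.*-identityˡ h))))
      (*-nonNeg 0≤p
        (*-nonNeg (≤⇒0≤- (α≤a (K ℕ.+ n) (ℕₚ.≤-trans N≤n (ℕₚ.m≤n+m n K)))) 0≤h))

------------------------------------------------------------------------
-- The weights and the decrease of the slack

-- The ratio of slack to x decreases: if g / x ≤ a - 2 - v with v ≥ 0, then the next ratio is
-- at most a - 2 - v - margin a.
descent : ∀ {a v x g} → 0ℚ ≤ a → a ≤ 3ℚ → 0ℚ ≤ margin a → 0ℚ ≤ v → 0ℚ ≤ x →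
          g ≤ (a - 2ℚ - v) * x →
          a * (a - 1ℚ) * g - x ≤ (a - 2ℚ - (margin a + v)) * (x + a * g)
descent {a} {v} {x} {g} 0≤a a≤3 0≤μ 0≤v 0≤x g≤ = ≤-by rest
  (subst (λ g → (a - 2ℚ - (margin a + v)) * (x + a * g) ≡ a * (a - 1ℚ) * g - x + rest)
    (ℚS.solve 2 (λ t g → t :- (t :- g) := g) refl ((a - 2ℚ - v) * x) g)
    (ℚS.solve 4 (λ a v x u →
      let k = con ⅓ :* (con 3ℚ :* a :- con 1ℚ :- a :* a)
          g = (a :- con 2ℚ :- v) :* x :- u in
      (a :- con 2ℚ :- (k :+ v)) :* (x :+ a :* g) :=
      a :* (a :- con 1ℚ) :* g :- x :+
        (x :* (k :* ((con 3ℚ :- a) :+ con 3ℚ :* k) :+ v :* (con 3ℚ :* k :+ a :* v)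
               :+ k :* (a :* v))
        :+ u :* (a :* (con 1ℚ :+ v :+ k)))) refl a v x u))
  (+-nonNeg
    (*-nonNeg 0≤x (+-nonNeg (+-nonNeg
      (*-nonNeg 0≤μ (+-nonNeg (≤⇒0≤- a≤3) (*-nonNeg 0≤3 0≤μ)))
      (*-nonNeg 0≤v (+-nonNeg (*-nonNeg 0≤3 0≤μ) (*-nonNeg 0≤a 0≤v))))
      (*-nonNeg 0≤μ (*-nonNeg 0≤a 0≤v))))
    (*-nonNeg (≤⇒0≤- g≤) (*-nonNeg 0≤a (+-nonNeg (+-nonNeg 0≤1 0≤v) 0≤μ))))
  where
  u = (a - 2ℚ - v) * x - g
  -- The difference of the two sides, as a combination of nonnegative terms.
  rest = x * (margin a * ((3ℚ - a) + 3ℚ * margin a) + v * (3ℚ * margin a + a * v)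
              + margin a * (a * v))
       + u * (a * (1ℚ + v + margin a))

  0≤3 : 0ℚ ≤ 3ℚ
  0≤3 = ℚₚ.<⇒≤ (ℚₚ.positive⁻¹ 3ℚ)

module Weights (a : ℚ) where
  -- x n and y n are the weights of the twins and of the bait n, Y n is the sum of y k and Z n the
  -- sum of x k + y k over k < n.  The weight x n + Y n is what the algorithm may hold, and
  -- x n + (x n + Z n) is that of the matching after the twin m has been added to it.  The
  -- positive part in y keeps all weights nonnegative; only rounds with a positive slack are
  -- played.
  x y Y Z slack : ℕ → ℚ
  x zero    = 1ℚ
  x (suc n) = x n + a * y n
  y n = 0ℚ ⊔ slack n
  Y zero    = 0ℚ
  Y (suc n) = y n + Y n
  Z zero    = 0ℚ
  Z (suc n) = y n + (x n + Z n)
  slack n = a * (x n + Y n) - (x n + (x n + Z n))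

  y≥0 : ∀ n → 0ℚ ≤ y n
  y≥0 n = ℚₚ.p≤p⊔q 0ℚ (slack n)

  slack-suc : ∀ n → y n ≡ slack n → slack (suc n) ≡ a * (a - 1ℚ) * slack n - x n
  slack-suc n eq = trans (cong next eq)
    (ℚS.solve 4 (λ a x Y Z →
      let g = a :* (x :+ Y) :- (x :+ (x :+ Z)) in
      a :* ((x :+ a :* g) :+ (g :+ Y))
        :- ((x :+ a :* g) :+ ((x :+ a :* g) :+ (g :+ (x :+ Z))))
      := a :* (a :- con 1ℚ) :* g :- x) refl a (x n) (Y n) (Z n))
    where
    next : ℚ → ℚ
    next w = a * ((x n + a * w) + (w + Y n))
      - ((x n + a * w) + ((x n + a * w) + (w + (x n + Z n))))

  module _ (0≤a : 0ℚ ≤ a) where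
    1≤x : ∀ n → 1ℚ ≤ x n
    1≤x zero    = ℚₚ.≤-refl
    1≤x (suc n) = ℚₚ.≤-trans (1≤x n) (≤-by (a * y n) refl (*-nonNeg 0≤a (y≥0 n)))

    x≥0 : ∀ n → 0ℚ ≤ x n
    x≥0 n = ℚₚ.≤-trans 0≤1 (1≤x n)

  -- From round n on, the slack stays positive for finitely many rounds and then is not.
  data Exhausted (n : ℕ) : Set where
    stop : slack n ≤ 0ℚ → Exhausted n
    go   : 0ℚ < slack n → Exhausted (suc n) → Exhausted n

  exhausted : 0ℚ ≤ a → 0ℚ < margin a → Exhausted 0
  exhausted 0≤a 0<μ = from (proj₁ bound) 0 0ℚ ℚₚ.≤-refl
    -- The initial slack is a - 2.
    (ℚₚ.≤-reflexive (ℚS.solve 1 (λ a →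
      a :* (con 1ℚ :+ con 0ℚ) :- (con 1ℚ :+ (con 1ℚ :+ con 0ℚ))
        := (a :- con 2ℚ :- con 0ℚ) :* con 1ℚ) refl a))
    (ℚₚ.≤-trans (≤-by (3ℚ - a)
        (ℚS.solve 1 (λ a → con 1ℚ := (a :- con 2ℚ) :+ (con 3ℚ :- a)) refl a) (≤⇒0≤- a≤3))
      (ℚₚ.≤-trans (proj₂ bound) (ℚₚ.≤-reflexive (sym (ℚₚ.+-identityʳ _)))))
    where
    a≤3 = 0<margin⇒≤3 0≤a 0<μ
    bound = multiple-unbounded (margin a) 0<μ

    -- v is a lower bound for the decrease of slack / x before round n, and k further rounds make
    -- the ratio nonpositive.
    from : ∀ k n v → 0ℚ ≤ v → slack n ≤ (a - 2ℚ - v) * x n →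
           a - 2ℚ ≤ multiple k (margin a) + v → Exhausted n
    from k n v 0≤v g≤ a-2≤ with slack n ℚₚ.≤? 0ℚ
    ... | yes g≤0 = stop g≤0
    from zero n v 0≤v g≤ a-2≤ | no g≰0 = stop (ℚₚ.≤-trans g≤
      (subst ((a - 2ℚ - v) * x n ≤_) (ℚₚ.*-zeroˡ (x n))
        (ℚₚ.*-monoʳ-≤-nonNeg (x n) {{ℚ.nonNegative (x≥0 0≤a n)}}
          (≤-by {a - 2ℚ - v} {0ℚ} (v - (a - 2ℚ))
            (ℚS.solve 2 (λ t v → con 0ℚ := (t :- v) :+ (v :- t)) refl (a - 2ℚ) v)
            (≤⇒0≤- (subst (a - 2ℚ ≤_) (ℚₚ.+-identityˡ v) a-2≤))))))
    from (suc k) n v 0≤v g≤ a-2≤ | no g≰0 = go 0<g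
      (from k (suc n) (margin a + v) (+-nonNeg (ℚₚ.<⇒≤ 0<μ) 0≤v)
        (subst₂ _≤_ (sym (slack-suc n y≡g))
          (cong (λ w → (a - 2ℚ - (margin a + v)) * (x n + a * w)) (sym y≡g))
          (descent 0≤a a≤3 (ℚₚ.<⇒≤ 0<μ) 0≤v (x≥0 0≤a n) g≤))
        (subst (a - 2ℚ ≤_) (ℚS.solve 3 (λ k m v → (k :+ m) :+ v := m :+ (k :+ v))
          refl (margin a) (multiple k (margin a)) v) a-2≤))
      where
      0<g = ℚₚ.≰⇒> g≰0
      y≡g : y n ≡ slack n
      y≡g = ℚₚ.p≤q⇒p⊔q≡q (ℚₚ.<⇒≤ 0<g)

------------------------------------------------------------------------
-- Optimal sets

-- A decidable family of subsets is empty or has a member of maximal value.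
argmax : ∀ {n} (P : Subset n → Set) → (∀ T → Dec (P T)) → (v : Subset n → ℚ) →
         (∃[ T ] P T × (∀ T′ → P T′ → v T′ ≤ v T)) ⊎ (∀ T → ¬ P T)
argmax {zero} P P? v with P? []
... | yes p = inj₁ ([] , p , λ { [] _ → ℚₚ.≤-refl })
... | no ¬p = inj₂ λ { [] → ¬p }
argmax {suc n} P P? v
  with argmax (λ T → P (inside ∷ T)) (λ T → P? (inside ∷ T)) (λ T → v (inside ∷ T))
     | argmax (λ T → P (outside ∷ T)) (λ T → P? (outside ∷ T)) (λ T → v (outside ∷ T))
... | inj₂ ¬i | inj₂ ¬o = inj₂ λ { (inside ∷ T) → ¬i T ; (outside ∷ T) → ¬o T }
... | inj₁ (T , p , max) | inj₂ ¬o = inj₁ (inside ∷ T , p ,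
  λ { (inside ∷ T′) → max T′ ; (outside ∷ T′) p′ → ⊥-elim (¬o T′ p′) })
... | inj₂ ¬i | inj₁ (T , p , max) = inj₁ (outside ∷ T , p ,
  λ { (inside ∷ T′) p′ → ⊥-elim (¬i T′ p′) ; (outside ∷ T′) → max T′ })
... | inj₁ (T , p , maxT) | inj₁ (U , q , maxU)
  with ℚₚ.≤-total (v (inside ∷ T)) (v (outside ∷ U))
... | inj₁ T≤U = inj₁ (outside ∷ U , q ,
  λ { (inside ∷ T′) p′ → ℚₚ.≤-trans (maxT T′ p′) T≤U ; (outside ∷ T′) → maxU T′ })
... | inj₂ U≤T = inj₁ (inside ∷ T , p ,
  λ { (inside ∷ T′) → maxT T′ ; (outside ∷ T′) p′ → ℚₚ.≤-trans (maxU T′ p′) U≤T })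

------------------------------------------------------------------------
-- Instances with rational weights

module RationalInstance
  (Item : Set) (_≟_ : DecidableEquality Item)
  (w : Item → ℚ) (w≥0 : ∀ u → 0ℚ ≤ w u) where

  inst : Instance
  inst = record
    { 𝒰 = Item ; _≟_ = _≟_ ; ν = λ u → fromℚ (w u)
    ; ν-nonNeg = λ { u (ε , 0<ε , N , w+ε<0) → <⇒≱ (w+ε<0 N ℕₚ.≤-refl)
        (+-nonNeg (w≥0 u) (ℚₚ.<⇒≤ 0<ε)) } }

  open Instance inst using (Ω; f; Independent; ∣_∩Ω_∣; independent?) public

  -- The sum of the weights in a list, counted with multiplicity.
  total : List Item → ℚ
  total L = foldr _+_ 0ℚ (map w L)

  -- f computed in the rationals.
  value : List Ω → ℚ
  value S = total (deduplicate _≟_ (map proj₁ S))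

  f-value : ∀ S k → seq (f S) k ≡ value S
  f-value S k = go (deduplicate _≟_ (map proj₁ S))
    where
    go : ∀ L → seq (foldr _+ᵣ_ 0ᵣ (map (λ u → fromℚ (w u)) L)) k ≡ total L
    go []      = refl
    go (u ∷ L) = cong (w u +_) (go L)

  total≥0 : ∀ L → 0ℚ ≤ total L
  total≥0 []      = ℚₚ.≤-refl
  total≥0 (u ∷ L) = +-nonNeg (w≥0 u) (total≥0 L)

  total-extract : ∀ K {u} L → total (K ++ u ∷ L) ≡ w u + total (K ++ L)
  total-extract []      L = refl
  total-extract (v ∷ K) {u} L = trans (cong (w v +_) (total-extract K L))
    (ℚS.solve 3 (λ v u t → v :+ (u :+ t) := u :+ (v :+ t)) refl (w v) (w u) (total (K ++ L)))

  total-⊆ : ∀ {L} B → List.Unique L → All (_∈ B) L → total L ≤ total B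
  total-⊆ B []           []         = total≥0 B
  total-⊆ {u ∷ L} B (u∉L ∷ L!) (u∈B ∷ L⊆B) with ∈-∃++ u∈B
  ... | K , M , refl = subst (w u + total L ≤_) (sym (total-extract K M))
    (ℚₚ.+-monoʳ-≤ (w u) (total-⊆ (K ++ M) L! (All.zipWith remove (u∉L , L⊆B))))
    where
    remove : ∀ {v} → (u ≢ v) × (v ∈ K ++ u ∷ M) → v ∈ K ++ M
    remove (u≢v , v∈) with ∈-++⁻ K v∈
    ... | inj₁ v∈K           = ∈-++⁺ˡ v∈K
    ... | inj₂ (here v≡u)    = ⊥-elim (u≢v (sym v≡u))
    ... | inj₂ (there v∈M)   = ∈-++⁺ʳ K v∈M

  value-≤ : ∀ {S} B → All (λ e → proj₁ e ∈ B) S → value S ≤ total B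
  value-≤ {S} B S⊆B = total-⊆ B (deduplicate-! _≟_ (map proj₁ S))
    (All.tabulate λ u∈ → All.lookup (Allₚ.map⁺ S⊆B) (∈-deduplicate⁻ _≟_ (map proj₁ S) u∈))

  -- Matchings of items to slots.  They are the independent sets without repeated items, so that
  -- their value is a plain sum.
  Disjoint : Ω → Ω → Set
  Disjoint (u , i) (v , j) = u ≢ v × i ≢ j

  Matching : List Ω → Set
  Matching = AllPairs Disjoint

  matching-value : ∀ {S} → Matching S → value S ≡ total (map proj₁ S)
  matching-value {S} m = cong total (dedup m)
    where
    dedup : ∀ {S} → Matching S → deduplicate _≟_ (map proj₁ S) ≡ map proj₁ S
    dedup []           = refl
    dedup {(u , i) ∷ S} (d ∷ m) = cong (u ∷_) (trans (cong (filter _) (dedup m))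
      (filter-all _ (Allₚ.map⁺ (All.map proj₁ d))))

  matching-independent : ∀ {S} → Matching S → Independent S
  matching-independent []      i = z≤n
  matching-independent {(u , j) ∷ S} (d ∷ m) i with j ℕ.≟ i
  ... | no j≢i   = subst (λ L → length L ℕ.≤ 1)
    (sym (filter-reject (λ e → proj₂ e ℕ.≟ i) j≢i)) (matching-independent m i)
  ... | yes refl = subst (λ L → length L ℕ.≤ 1)
    (sym (trans (filter-accept (λ e → proj₂ e ℕ.≟ i) refl)
      (cong ((u , j) ∷_) (filter-none (λ e → proj₂ e ℕ.≟ i)
        (All.map (λ d′ j≡i → proj₂ d′ (sym j≡i)) d)))))
    (s≤s z≤n)

  unoccupied : ∀ S i → ∣ S ∩Ω i ∣ ℕ.≤ 0 → All (λ e → proj₂ e ≢ i) S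
  unoccupied []            i _ = []
  unoccupied ((u , j) ∷ S) i n≤0 with j ℕ.≟ i
  ... | no j≢i = j≢i ∷ unoccupied S i
    (subst (λ L → length L ℕ.≤ 0) (filter-reject (λ e → proj₂ e ℕ.≟ i) j≢i) n≤0)
  ... | yes refl with subst (λ L → length L ℕ.≤ 0)
                        (filter-accept (λ e → proj₂ e ℕ.≟ i) {u , j} {S} refl) n≤0
  ... | ()

  optimum : ∀ {n} (σ : Vec Ω n) T → Independent (select σ T) →
            ∃[ OPT ] IsOptimal inst σ OPT × value (select σ T) ≤ value (select σ OPT)
  optimum σ T ind
    with argmax (λ U → Independent (select σ U)) (λ U → independent? (select σ U))
                (λ U → value (select σ U))
  ... | inj₂ none = ⊥-elim (none T ind)
  ... | inj₁ (OPT , ind′ , max) = OPT , (ind′ , λ U indU → f≤f U (max U indU)) , max T ind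
    where
    f≤f : ∀ U → value (select σ U) ≤ value (select σ OPT) →
          f (select σ U) ≤ᵣ f (select σ OPT)
    f≤f U v≤ (ε , 0<ε , N , lt) = <⇒≱
      (subst₂ (λ p q → p + ε < q) (f-value (select σ OPT) N) (f-value (select σ U) N)
        (lt N ℕₚ.≤-refl))
      (ℚₚ.≤-trans v≤ (≤-by ε refl (ℚₚ.<⇒≤ 0<ε)))

  select-∩ : ∀ {P : Ω → Set} {n} (σ : Vec Ω n) K S →
             All P (select σ S) → All P (select σ (K ∩ S))
  select-∩ []      []            []            ps       = []
  select-∩ (e ∷ σ) (outside ∷ K) (inside  ∷ S) (p ∷ ps) = select-∩ σ K S ps
  select-∩ (e ∷ σ) (outside ∷ K) (outside ∷ S) ps       = select-∩ σ K S ps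
  select-∩ (e ∷ σ) (inside  ∷ K) (inside  ∷ S) (p ∷ ps) = p ∷ select-∩ σ K S ps
  select-∩ (e ∷ σ) (inside  ∷ K) (outside ∷ S) ps       = select-∩ σ K S ps

  -- What the adversary uses of an algorithm of ratio greater than 1/a on this instance: the
  -- elements held after a sequence of arrivals, what a single arrival can change, and that every
  -- matching of arrived elements with positive value is worth less than a times the held weight.
  -- In arrival, either e is not held and all held elements were held before, or e has displaced
  -- the elements at its slot.
  record Competitor (a : ℚ) : Set₁ where
    field
      held        : ∀ {n} → Vec Ω n → List Ω
      held-[]     : held [] ≡ []
      arrival     : ∀ {n} (P : Ω → Set) {e} {σ : Vec Ω n} → Unique (e ∷ σ) → All P (held σ) →
                    All P (held (e ∷ σ)) ⊎
                    All (λ h → h ≡ e ⊎ (P h × proj₂ h ≢ proj₂ e)) (held (e ∷ σ))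
      competitive : ∀ {n} {σ : Vec Ω n} → Unique σ → ∀ T → Matching (select σ T) →
                    0ℚ < value (select σ T) → value (select σ T) < a * value (held σ)

    -- A property of e and of the held elements survives the arrival of e.
    arrival-preserves : ∀ {n} (P : Ω → Set) {e} {σ : Vec Ω n} → Unique (e ∷ σ) → All P (held σ) →
                P e → All P (held (e ∷ σ))
    arrival-preserves P {e} unique ps pe with arrival P unique ps
    ... | inj₁ ps′ = ps′
    ... | inj₂ ps′ = All.map (λ { (inj₁ refl) → pe ; (inj₂ (p , _)) → p }) ps′

  module Run (A : Algorithm) (ind : MaintainsIndependence A) where

    -- The elements held after the arrivals σ.
    held : ∀ {n} → Vec Ω n → List Ω
    held σ = select σ (run inst A σ)

    -- Independence allows only one element at the slot of e.
    run-arrival : ∀ {n} (P : Ω → Set) {e} {σ : Vec Ω n} → Unique (e ∷ σ) → All P (held σ) →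
                  All P (held (e ∷ σ)) ⊎
                  All (λ h → h ≡ e ⊎ (P h × proj₂ h ≢ proj₂ e)) (held (e ∷ σ))
    run-arrival P {e} {σ} unique ps =
      cases (accept v ι (run inst A σ)) (keep v ι (run inst A σ)) (ind inst (e ∷ σ) unique)
      where
      open Algorithm A
      v = valueOracle inst (e ∷ σ)
      ι = independenceOracle inst (e ∷ σ)

      cases : ∀ b K → let R = K ∩ run inst A σ in Independent (select (e ∷ σ) (b ∷ R)) →
              All P (select (e ∷ σ) (b ∷ R)) ⊎
              All (λ h → h ≡ e ⊎ (P h × proj₂ h ≢ proj₂ e)) (select (e ∷ σ) (b ∷ R))
      cases outside K _ = inj₁ (select-∩ σ K (run inst A σ) ps)
      cases inside  K I = inj₂ (inj₁ refl ∷ All.map inj₂ (All.zip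
        (select-∩ σ K (run inst A σ) ps ,
         unoccupied (select σ (K ∩ run inst A σ)) (proj₂ e)
          (ℕₚ.≤-pred (subst (λ L → length L ℕ.≤ 1)
            (filter-accept (λ h → proj₂ h ℕ.≟ proj₂ e) refl) (I (proj₂ e)))))))

    competitor : ∀ {α r a} (0<α : 0ᵣ <ᵣ α) → inverse α 0<α <ᵣ r → HasCompetitiveRatio A r →
                 (∃[ N ] (∀ n → N ℕ.≤ n → seq α n ≤ a)) → Competitor a
    competitor {α} {r} {a} 0<α r> ratio α≤a = record
      { held = held ; held-[] = refl ; arrival = run-arrival
      ; competitive = λ {_} {σ} unique T matching 0<T → ℚₚ.≰⇒> λ ah≤T →
          refute σ unique (optimum σ T (matching-independent matching)) 0<T ah≤T }
      where
      refute : ∀ {n} (σ : Vec Ω n) → Unique σ → ∀ {t} →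
               ∃[ OPT ] IsOptimal inst σ OPT × t ≤ value (select σ OPT) →
               0ℚ < t → a * value (held σ) ≤ t → ⊥
      refute σ unique (OPT , isOpt , t≤OPT) 0<t ah≤t = ratio inst σ unique OPT isOpt
        (let (ε , 0<ε , N , h+ε<ro) = exceeds {α = α} {r = r} {a = a} 0<α r> α≤a
                                        (total≥0 (deduplicate _≟_ (map proj₁ (held σ))))
                                        (ℚₚ.<-≤-trans 0<t t≤OPT) (ℚₚ.≤-trans ah≤t t≤OPT)
         in ε , 0<ε , N , λ n N≤n → subst₂ (λ p q → p + ε < seq r n * q)
              (sym (f-value (held σ) n)) (sym (f-value (select σ OPT) n)) (h+ε<ro n N≤n))

------------------------------------------------------------------------
-- The adversary

-- The two twins n have the same weight and compete for slot 0.
data Item : Set where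
  twin : ℕ → Bool → Item
  bait : ℕ → Item

_≟ᵢ_ : DecidableEquality Item
twin m b ≟ᵢ twin n c with m ℕ.≟ n | b Bool.≟ c
... | yes refl | yes refl = yes refl
... | no m≢n   | _        = no λ { refl → m≢n refl }
... | yes _    | no b≢c   = no λ { refl → b≢c refl }
twin _ _ ≟ᵢ bait _ = no λ ()
bait _ ≟ᵢ twin _ _ = no λ ()
bait m ≟ᵢ bait n with m ℕ.≟ n
... | yes refl = yes refl
... | no m≢n   = no λ { refl → m≢n refl }

index : Item → ℕ
index (twin n _) = n
index (bait n)   = n

-- Before round n, the slots 0, ..., slots n have been used.
slots : ℕ → ℕ
slots zero    = 0
slots (suc n) = suc (suc (slots n))

-- The baits of the rounds before n.
baits : ℕ → List Item
baits zero    = []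
baits (suc n) = bait n ∷ baits n

-- The instance of the game.
module Game (a : ℚ) (0≤a : 0ℚ ≤ a) where

  open Weights a

  weight : Item → ℚ
  weight (twin n _) = x n
  weight (bait n)   = y n

  weight≥0 : ∀ u → 0ℚ ≤ weight u
  weight≥0 (twin n _) = x≥0 0≤a n
  weight≥0 (bait n)   = y≥0 n

  open RationalInstance Item _≟ᵢ_ weight weight≥0 public

module Adversary (a : ℚ) (0≤a : 0ℚ ≤ a) (C : Game.Competitor a 0≤a a) where

  open Weights a
  open Game a 0≤a
  open Competitor C

  total-baits : ∀ n → total (baits n) ≡ Y n
  total-baits zero    = refl
  total-baits (suc n) = cong (y n +_) (total-baits n)

  -- Bounds on the items and slots that have arrived.  They show that later elements are new.
  Known : ∀ {len} → ℕ → ℕ → Vec Ω len → Set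
  Known i s = VAll.All (λ e → index (proj₁ e) ℕ.≤ i × proj₂ e ℕ.≤ s)

  widen : ∀ {i j s t len} {σ : Vec Ω len} → i ℕ.≤ j → s ℕ.≤ t → Known i s σ → Known j t σ
  widen i≤j s≤t = VAll.map λ (p , q) → ℕₚ.≤-trans p i≤j , ℕₚ.≤-trans q s≤t

  new-slot : ∀ {i s t u len} {σ : Vec Ω len} → Known i s σ → s ℕ.< t → VAll.All ((u , t) ≢_) σ
  new-slot known s<t = VAll.map (λ { (_ , t≤s) refl → ℕₚ.<⇒≱ s<t t≤s }) known

  new-index : ∀ {i s t u len} {σ : Vec Ω len} →
              Known i s σ → i ℕ.< index u → VAll.All ((u , t) ≢_) σ
  new-index known i<u = VAll.map (λ { (u≤i , _) refl → ℕₚ.<⇒≱ i<u u≤i }) known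

  -- Bounds on the part of the matching outside slot 0.
  Hosted : ℕ → Ω → Set
  Hosted n (u , i) = index u ℕ.< n × 0 ℕ.< i × i ℕ.≤ slots n

  -- The elements that the algorithm may hold at the start of round n, b naming the twin.
  Held : ℕ → Bool → Ω → Set
  Held n b e = e ≡ (twin n b , 0) ⊎ proj₁ e ∈ baits n

  -- The start of round n.  T is the matching outside slot 0, and T⁺ also contains, at slot 0,
  -- the twin n that is not held.
  record Stage (n : ℕ) : Set where
    field
      {len}    : ℕ
      σ        : Vec Ω len
      unique   : Unique σ
      known    : Known n (slots n) σ
      b        : Bool
      T T⁺     : Subset len
      T⁺≡      : select σ T⁺ ≡ (twin n (not b) , 0) ∷ select σ T
      matching : Matching (select σ T)
      hosted   : All (Hosted n) (select σ T)
      T-total  : total (map proj₁ (select σ T)) ≡ Z n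
      held⊆    : All (Held n b) (held σ)

  -- Once one twin n has arrived at slot 0 and nothing but this element and baits can be held, the
  -- arrival of the other twin leads to the start of round n, whatever the algorithm does.
  settle : ∀ n {len} {σ : Vec Ω len} → let σ₁ = (twin n false , 0) ∷ σ in
           Unique ((twin n true , 0) ∷ σ₁) → Known n (slots n) σ → ∀ T →
           Matching (select σ T) → All (Hosted n) (select σ T) →
           total (map proj₁ (select σ T)) ≡ Z n → All (Held n false) (held σ₁) → Stage n
  settle n {σ = σ} unique known T matching hosted T-total held⊆
    with arrival (Held n false) unique held⊆
  ... | inj₁ rejected = record
    { σ = (twin n true , 0) ∷ (twin n false , 0) ∷ σ ; unique = unique
    ; known = (ℕₚ.≤-refl , z≤n) ∷ (ℕₚ.≤-refl , z≤n) ∷ known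
    ; b = false ; T = outside ∷ outside ∷ T ; T⁺ = inside ∷ outside ∷ T ; T⁺≡ = refl
    ; matching = matching ; hosted = hosted ; T-total = T-total ; held⊆ = rejected }
  ... | inj₂ accepted = record
    { σ = (twin n true , 0) ∷ (twin n false , 0) ∷ σ ; unique = unique
    ; known = (ℕₚ.≤-refl , z≤n) ∷ (ℕₚ.≤-refl , z≤n) ∷ known
    ; b = true ; T = outside ∷ outside ∷ T ; T⁺ = outside ∷ inside ∷ T ; T⁺≡ = refl
    ; matching = matching ; hosted = hosted ; T-total = T-total
    ; held⊆ = All.map (λ { (inj₁ refl)              → inj₁ refl
                         ; (inj₂ (inj₁ refl , 0≢0)) → ⊥-elim (0≢0 refl)
                         ; (inj₂ (inj₂ e∈ , _))     → inj₂ e∈ }) accepted }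

  first-stage : Stage 0
  first-stage = settle 0 (((λ ()) ∷ []) ∷ [] ∷ []) [] [] [] [] refl
    (arrival-preserves (Held 0 false) {e = twin 0 false , 0} {σ = []} ([] ∷ [])
      (subst (All (Held 0 false)) (sym held-[]) []) (inj₁ refl))

  -- No matching is worth a times the weight of a list B that contains all held items.  The
  -- matching is written with a twin first, which makes its value positive.
  violation : ∀ {n len} {σ : Vec Ω len} → Unique σ → ∀ T {b i S} →
              select σ T ≡ (twin n b , i) ∷ S → Matching ((twin n b , i) ∷ S) →
              ∀ B → All (λ h → proj₁ h ∈ B) (held σ) →
              a * total B ≤ x n + total (map proj₁ S) → ⊥
  violation {n} {σ = σ} unique T {b} {i} {S} T≡ matching B held⊆B aB≤ =
    <⇒≱ (competitive unique T (subst Matching (sym T≡) matching) (subst (0ℚ <_) (sym value≡) 0<))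
      (ℚₚ.≤-trans (ℚₚ.*-monoˡ-≤-nonNeg a {{ℚ.nonNegative 0≤a}} (value-≤ B held⊆B))
        (subst (a * total B ≤_) (sym value≡) aB≤))
    where
    value≡ : value (select σ T) ≡ x n + total (map proj₁ S)
    value≡ = trans (cong value T≡) (matching-value matching)
    0< : 0ℚ < x n + total (map proj₁ S)
    0< = ℚₚ.+-mono-<-≤ (ℚₚ.<-≤-trans (ℚₚ.positive⁻¹ 1ℚ) (1≤x 0≤a n)) (total≥0 (map proj₁ S))

  -- Here m is the twin that may be held, d the other one and p the first twin of round n + 1.
  -- The arrivals σ₁, σ₂, σ₃, σ₄ continue the round, and σ₃′ ends the game after σ₂.
  module Round {n} (stage : Stage n) where
    open Stage stage

    m d p : Item
    m = twin n b
    d = twin n (not b)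
    p = twin (suc n) false

    s₁ s₂ : ℕ
    s₁ = suc (slots n)
    s₂ = suc s₁

    σ₁ : Vec Ω (suc len)
    σ₁ = (m , s₁) ∷ σ
    σ₂ : Vec Ω (suc (suc len))
    σ₂ = (bait n , s₁) ∷ σ₁
    σ₃ σ₃′ : Vec Ω (suc (suc (suc len)))
    σ₃  = (bait n , s₂) ∷ σ₂
    σ₃′ = (m , s₂) ∷ σ₂
    σ₄ : Vec Ω (suc (suc (suc (suc len))))
    σ₄ = (p , 0) ∷ σ₃

    known₂ : Known n s₁ σ₂
    known₂ = (ℕₚ.≤-refl , ℕₚ.≤-refl) ∷ (ℕₚ.≤-refl , ℕₚ.≤-refl)
      ∷ widen ℕₚ.≤-refl (ℕₚ.n≤1+n _) known
    known₃ : Known n s₂ σ₃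
    known₃ = (ℕₚ.≤-refl , ℕₚ.≤-refl) ∷ widen ℕₚ.≤-refl (ℕₚ.n≤1+n _) known₂

    unique₁ : Unique σ₁
    unique₁ = new-slot known ℕₚ.≤-refl ∷ unique
    unique₂ : Unique σ₂
    unique₂ = ((λ ()) ∷ new-slot known ℕₚ.≤-refl) ∷ unique₁
    unique₃ : Unique σ₃
    unique₃ = new-slot known₂ ℕₚ.≤-refl ∷ unique₂
    unique₃′ : Unique σ₃′
    unique₃′ = new-slot known₂ ℕₚ.≤-refl ∷ unique₂
    unique₄ : Unique σ₄
    unique₄ = new-index known₃ ℕₚ.≤-refl ∷ unique₃

    L = select σ T

    d-total : total (map proj₁ ((d , 0) ∷ L)) ≡ x n + Z n
    d-total = cong (x n +_) T-total

    disjoint : ∀ {u t} → n ℕ.≤ index u → t ≡ 0 ⊎ slots n ℕ.< t → All (Disjoint (u , t)) L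
    disjoint n≤u t-new = All.map (λ { (i<n , 0<i , i≤s) →
      (λ { refl → ℕₚ.<⇒≱ i<n n≤u }) ,
      λ { refl → [ (λ { refl → ℕₚ.n≮n 0 0<i }) , (λ s<t → ℕₚ.<⇒≱ s<t i≤s) ]′ t-new } }) hosted

    m≢d : m ≢ d
    m≢d m≡d = not-¬ refl (twin-injective m≡d)
      where
      twin-injective : ∀ {n b c} → twin n b ≡ twin n c → b ≡ c
      twin-injective refl = refl

    slots<s₂ : slots n ℕ.< s₂
    slots<s₂ = ℕₚ.n≤1+n s₁

    matching-d : Matching ((d , 0) ∷ L)
    matching-d = disjoint ℕₚ.≤-refl (inj₁ refl) ∷ matching

    matching₁ : Matching ((m , s₁) ∷ (d , 0) ∷ L)
    matching₁ = ((m≢d , λ ()) ∷ disjoint ℕₚ.≤-refl (inj₂ ℕₚ.≤-refl)) ∷ matching-d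

    matching₂ : Matching ((m , s₂) ∷ (bait n , s₁) ∷ (d , 0) ∷ L)
    matching₂ = (((λ ()) , ℕₚ.1+n≢n) ∷ (m≢d , λ ()) ∷ disjoint ℕₚ.≤-refl (inj₂ slots<s₂))
      ∷ (((λ ()) , λ ()) ∷ disjoint ℕₚ.≤-refl (inj₂ ℕₚ.≤-refl)) ∷ matching-d

    matching₃ : Matching ((bait n , s₂) ∷ (m , s₁) ∷ L)
    matching₃ = (((λ ()) , ℕₚ.1+n≢n) ∷ disjoint ℕₚ.≤-refl (inj₂ slots<s₂))
      ∷ disjoint ℕₚ.≤-refl (inj₂ ℕₚ.≤-refl) ∷ matching

    matching₄ : Matching ((p , 0) ∷ (bait n , s₂) ∷ (m , s₁) ∷ L)
    matching₄ = (((λ ()) , λ ()) ∷ ((λ ()) , λ ()) ∷ disjoint (ℕₚ.n≤1+n n) (inj₁ refl))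
      ∷ matching₃

    -- After σ₁ the algorithm may hold a second copy of m.
    Copied : Ω → Set
    Copied e = Held n b e ⊎ e ≡ (m , s₁)

    held₁ : All Copied (held σ₁)
    held₁ = arrival-preserves Copied unique₁ (All.map inj₁ held⊆) (inj₂ refl)

    copied-item : ∀ {e} → Copied e → proj₁ e ∈ m ∷ baits n
    copied-item (inj₁ (inj₁ refl)) = here refl
    copied-item (inj₁ (inj₂ e∈))   = there e∈
    copied-item (inj₂ refl)        = here refl

    -- Without slack, the copy of m at s₁ completes a matching that defeats the algorithm.
    finish₁ : slack n ≤ 0ℚ → ⊥
    finish₁ g≤0 = violation unique₁ (inside ∷ T⁺) (cong ((m , s₁) ∷_) T⁺≡) matching₁ (m ∷ baits n)
      (All.map copied-item held₁)
      (subst₂ _≤_ (cong (λ j → a * (x n + j)) (sym (total-baits n))) (cong (x n +_) (sym d-total))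
        (≤-by (0ℚ - slack n) (ℚS.solve 2 (λ l s → s := l :+ (con 0ℚ :- (l :- s))) refl
          (a * (x n + Y n)) (x n + (x n + Z n))) (≤⇒0≤- g≤0)))

    module Continue (0<g : 0ℚ < slack n) where
      y≡g : y n ≡ slack n
      y≡g = ℚₚ.p≤q⇒p⊔q≡q (ℚₚ.<⇒≤ 0<g)

      -- The bait was rejected at s₁.  Its weight is the slack, and m is matched at s₂.
      finish₂ : All Copied (held σ₂) → ⊥
      finish₂ held₂ = violation unique₃′ (inside ∷ inside ∷ outside ∷ T⁺)
        (cong (λ S → (m , s₂) ∷ (bait n , s₁) ∷ S) T⁺≡) matching₂ (m ∷ baits n)
        (arrival-preserves (λ h → proj₁ h ∈ m ∷ baits n) unique₃′ (All.map copied-item held₂)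
          (here refl))
        (ℚₚ.≤-reflexive (trans (cong (λ j → a * (x n + j)) (total-baits n))
          (trans (ℚS.solve 4 (λ a x Y Z → a :* (x :+ Y) :=
              x :+ ((a :* (x :+ Y) :- (x :+ (x :+ Z))) :+ (x :+ Z))) refl a (x n) (Y n) (Z n))
            (cong₂ (λ u v → x n + (u + v)) (sym y≡g) (sym d-total)))))

      -- The bait was accepted at s₁, so m is held at slot 0 only.
      held₃ : All (λ e → e ≡ (bait n , s₁) ⊎ (Copied e × proj₂ e ≢ s₁)) (held σ₂) →
              All (λ e → e ≡ (m , 0) ⊎ proj₁ e ∈ baits (suc n)) (held σ₃)
      held₃ held₂ = arrival-preserves _ unique₃ (All.map (λ
        { (inj₁ refl)                      → inj₂ (here refl)
        ; (inj₂ (inj₁ (inj₁ e≡) , _))      → inj₁ e≡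
        ; (inj₂ (inj₁ (inj₂ e∈) , _))      → inj₂ (there e∈)
        ; (inj₂ (inj₂ refl , s≢s))         → ⊥-elim (s≢s refl) }) held₂) (inj₂ (here refl))

      -- The new twin was rejected at slot 0.  Its weight x n + a y n makes up for d, whose place
      -- in the matching it takes, and for the bait that the algorithm has gained.
      finish₄ : All (λ e → e ≡ (m , 0) ⊎ proj₁ e ∈ baits (suc n)) (held σ₄) → ⊥
      finish₄ held₄ = violation unique₄ (inside ∷ inside ∷ outside ∷ inside ∷ T) refl matching₄
        (m ∷ baits (suc n)) (All.map (λ { (inj₁ refl) → here refl ; (inj₂ e∈) → there e∈ }) held₄)
        (ℚₚ.≤-reflexive (trans (cong (λ j → a * (x n + (y n + j))) (total-baits n))
          (trans (subst (λ w → a * (x n + (w + Y n)) ≡ (x n + a * w) + (w + (x n + Z n))) (sym y≡g)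
            (ℚS.solve 4 (λ a x Y Z → let g = a :* (x :+ Y) :- (x :+ (x :+ Z)) in
              a :* (x :+ (g :+ Y)) := (x :+ a :* g) :+ (g :+ (x :+ Z))) refl a (x n) (Y n) (Z n)))
            (cong (λ q → (x n + a * y n) + (y n + (x n + q))) (sym T-total)))))

      -- The new twin was accepted at slot 0, so m is lost.
      next : All (λ e → e ≡ (p , 0) ⊎ ((e ≡ (m , 0) ⊎ proj₁ e ∈ baits (suc n)) × proj₂ e ≢ 0))
                 (held σ₄) →
             Stage (suc n)
      next held₄ = settle (suc n)
        (((λ ()) ∷ new-index known₃ ℕₚ.≤-refl) ∷ unique₄)
        (widen (ℕₚ.n≤1+n n) ℕₚ.≤-refl known₃) (inside ∷ outside ∷ inside ∷ T) matching₃
        ((ℕₚ.≤-refl , s≤s z≤n , ℕₚ.≤-refl) ∷ (ℕₚ.≤-refl , s≤s z≤n , ℕₚ.n≤1+n s₁) ∷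
          All.map (λ (i<n , 0<i , i≤s) →
            ℕₚ.m≤n⇒m≤1+n i<n , 0<i , ℕₚ.≤-trans i≤s (ℕₚ.<⇒≤ slots<s₂)) hosted)
        (cong (λ q → y n + (x n + q)) T-total)
        (All.map (λ { (inj₁ e≡)               → inj₁ e≡
                    ; (inj₂ (inj₁ refl , 0≢0)) → ⊥-elim (0≢0 refl)
                    ; (inj₂ (inj₂ e∈ , _))     → inj₂ e∈ }) held₄)

      continue : Stage (suc n)
      continue with arrival Copied unique₂ held₁
      ... | inj₁ held₂ = ⊥-elim (finish₂ held₂)
      ... | inj₂ held₂ with arrival _ unique₄ (held₃ held₂)
      ...   | inj₁ held₄ = ⊥-elim (finish₄ held₄)
      ...   | inj₂ held₄ = next held₄

  play : ∀ {n} → Exhausted n → Stage n → ⊥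
  play (stop g≤0)    stage = Round.finish₁ stage g≤0
  play (go 0<g rest) stage = play rest (Round.Continue.continue stage 0<g)

theorem6p2 : (α : ℝ) (0<α : 0ᵣ <ᵣ α) → α <ᵣ [3+√5]/2 →
    ¬ (∃[ A ] MaintainsIndependence A ×
    (∃[ r ] (inverse α 0<α <ᵣ r) × HasCompetitiveRatio A r))
theorem6p2 α 0<α α<φ² (A , ind , r , r> , ratio) = beaten (rationalBound α 0<α α<φ²)
  where
  beaten : ∃[ a ] 0ℚ ≤ a × 0ℚ < margin a × (∃[ N ] (∀ n → N ℕ.≤ n → seq α n ≤ a)) → ⊥
  beaten (a , 0≤a , 0<μ , α≤a) = play (exhausted 0≤a 0<μ) first-stage
    where
    open Weights a
    open Game a 0≤a
    open Adversary a 0≤a (Run.competitor A ind {α} {r} {a} 0<α r> ratio α≤a)
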